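{- Let $m\ge 2$ and $\tau\in S_m$. Let $n\ge 3$, $l\in\{2,\dots,n-1\}$ and $k\in\mathbb{N}$ with $k\ge 1$ and $k+l-1\le n$. (i) For every such $\tau$, $$P_n^{\mathrm{av}(\tau)}(A^{(n)}_{l;k})\le\frac{|S_{n-l+1}(\tau)|\,|S_l(\tau)|}{|S_n(\tau)|}.$$ (ii) If $\tau$ is cluster-free, then $$P_n^{\mathrm{av}(\tau)}(A^{(n)}_{l;k})=\frac{|S_{n-l+1}(\tau)|\,|S_l(\tau)|}{|S_n(\tau)|}.$$ (iii) If there is at least one of the two patterns $12$ and $21$ that $\tau$ does not contain tightly, then $$P_n^{\mathrm{av}(\tau)}(A^{(n)}_{l;k})\ge\frac{|S_{n-l+1}(\tau)|}{|S_n(\tau)|}.$$ If in fact $\tau$ contains tightly neither $12$ nor $21$, then $$P_n^{\mathrm{av}(\tau)}(A^{(n)}_{l;k})\ge\frac{2\,|S_{n-l+1}(\tau)|}{|S_n(\tau)|}.$$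
   Context: $S_n$ is the set of permutations of $[n]=\{1,\dots,n\}$, written $\sigma=\sigma_1\sigma_2\cdots\sigma_n$. For $l\in\{2,\dots,n-1\}$ and $k\ge1$ with $k+l-1\le n$, $A^{(n)}_{l;k}\subset S_n$ is the set of $\sigma\in S_n$ for which there exists $a$ with $\{k,k+1,\dots,k+l-1\}=\{\sigma_a,\sigma_{a+1},\dots,\sigma_{a+l-1}\}$. For $\tau\in S_m$ with $2\le m\le n$, $\sigma\in S_n$ contains $\tau$ as a pattern if there are indices $1\le i_1<\cdots<i_m\le n$ such that for all $1\le j,j'\le m$, $\sigma_{i_j}<\sigma_{i_{j'}}$ if and only if $\tau_j<\tau_{j'}$; otherwise $\sigma$ avoids $\tau$. $S_n(\tau)$ is the set of $\sigma\in S_n$ avoiding $\tau$; if $n<m$, $S_n(\tau)=S_n$. $P_n^{\mathrm{av}(\tau)}$ is the uniform probability measure on $S_n(\tau)$, so $P_n^{\mathrm{av}(\tau)}(A)=|A\cap S_n(\tau)|/|S_n(\tau)|$ for $A\subset S_n$. $\tau\in S_m$ contains $12$ tightly if for some $i,h$ one has $\tau_i=h$ and $\tau_{i+1}=h+1$; it contains $21$ tightly if for some $i,h$ one has $\tau_i=h+1$ and $\tau_{i+1}=h$. $\tau\in S_m$ is cluster-free if $\tau\notin A^{(m)}_{l';k'}$ for all $l'\in\{2,\dots,m-1\}$ and all $k'\in\mathbb{N}$, $k'\ge1$, with $k'+l'-1\le m$. -}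

module Defs where

open import Data.Fin.Base as Fin using (Fin; zero; suc; toℕ)
open import Data.Fin.Permutation as Perm
  using (Permutation′; _⟨$⟩ʳ_; insert; remove; reverse)
open import Data.Fin.Properties as Fin using (any?; all?)
open import Data.Integer.Base using (+_)
open import Data.List.Base
  using (List; []; _∷_; allFin; cartesianProductWith; filter; length)
open import Data.List.Membership.Propositional.Properties using (∈-allFin)
import Data.List.Membership.Setoid.Properties as Membership
open import Data.List.Properties using (filter-some)
import Data.List.Relation.Unary.All as All
import Data.List.Relation.Unary.AllPairs as AllPairs
open import Data.List.Relation.Unary.Any as Any using (here)
open import Data.List.Relation.Unary.Enumerates.Setoid using (IsEnumeration)
open import Data.List.Relation.Unary.Unique.Propositional.Properties using (allFin⁺)
open import Data.List.Relation.Unary.Unique.Setoid using (Unique)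
open import Data.List.Relation.Unary.Unique.Setoid.Properties using (cartesianProductWith⁺)
open import Data.Nat.Base
open import Data.Nat.Properties as ℕ using (_≤?_; _<?_)
open import Data.Product.Base using (∃; ∃-syntax; _×_; _,_)
open import Data.Rational.Base as ℚ using (ℚ)
open import Data.Vec.Base using (Vec; []; _∷_; lookup)
open import Function.Bundles using (_⇔_; mk⇔; module Equivalence)
open import Level using (0ℓ)
open import Relation.Binary.Bundles using (Setoid)
open import Relation.Binary.Definitions using (tri<; tri≈; tri>)
open import Relation.Binary.PropositionalEquality
  using (_≡_; refl; sym; trans; cong; subst₂; setoid)
open import Relation.Nullary using (¬_; Dec; contradiction)
open import Relation.Nullary.Decidable using (map′; ¬?; _×-dec_; _→-dec_)
open import Relation.Unary using (Pred; Decidable)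
open import Relation.Unary.Properties using (_∩?_)

private
  variable
    m n : ℕ

-- Positions and values are elements of Fin n; val i ∈ {1,…,n} is the number
-- in [n] that i : Fin n stands for.
val : Fin n → ℕ
val i = suc (toℕ i)

-- Permutations are records containing functions, so they are compared pointwise.
S-setoid : ℕ → Setoid 0ℓ 0ℓ
S-setoid n = record
  { Carrier       = Permutation′ n
  ; _≈_           = Perm._≈_
  ; isEquivalence = record
    { refl  = λ _ → refl
    ; sym   = λ p i → sym (p i)
    ; trans = λ p q i → trans (p i) (q i)
    }
  }

-- Choose σ₁, then the relative order of the remaining entries.
permutations : ∀ n → List (Permutation′ n)
permutations zero    = Perm.id ∷ []
permutations (suc n) = cartesianProductWith (insert zero) (allFin (suc n)) (permutations n)

private
  insert-cong : ∀ {v w : Fin (suc n)} {π ρ : Permutation′ n} → v ≡ w → π Perm.≈ ρ →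
                insert zero v π Perm.≈ insert zero w ρ
  insert-cong refl p zero = refl
  insert-cong {v = v} {π = π} {ρ} refl p (suc i) = trans
    (Perm.insert-punchIn zero v π i)
    (trans (cong (Fin.punchIn v) (p i)) (sym (Perm.insert-punchIn zero v ρ i)))

  insert-injective : ∀ {v w : Fin (suc n)} {π ρ : Permutation′ n} →
                     insert zero v π Perm.≈ insert zero w ρ → v ≡ w × π Perm.≈ ρ
  insert-injective {v = v} {w} {π} {ρ} p with refl ← p zero = refl , λ i →
    Fin.punchIn-injective v _ _
      (trans (sym (Perm.insert-punchIn zero v π i))
             (trans (p (suc i)) (Perm.insert-punchIn zero v ρ i)))

permutations-complete : ∀ n → IsEnumeration (S-setoid n) (permutations n)
permutations-complete zero    σ = here λ ()
permutations-complete (suc n) σ =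
  Membership.∈-resp-≈ (S-setoid (suc n))
    {x = insert zero (σ ⟨$⟩ʳ zero) (remove zero σ)} {σ} (Perm.insert-remove zero σ)
    (Membership.∈-cartesianProductWith⁺ (setoid _) (S-setoid n) (S-setoid (suc n))
      (λ {v} {w} {π} {ρ} → insert-cong {v = v} {w} {π} {ρ})
      (∈-allFin (σ ⟨$⟩ʳ zero)) (permutations-complete n (remove zero σ)))

permutations-unique : ∀ n → Unique (S-setoid n) (permutations n)
permutations-unique zero    = All.[] AllPairs.∷ AllPairs.[]
permutations-unique (suc n) =
  cartesianProductWith⁺ (setoid _) (S-setoid n) (S-setoid (suc n)) (insert zero)
    (λ {v} {w} {π} {ρ} → insert-injective {v = v} {w} {π} {ρ})
    (allFin⁺ (suc n)) (permutations-unique n)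

∣_∣ : {E : Pred (Permutation′ n) 0ℓ} → Decidable E → ℕ
∣_∣ {n} E? = length (filter E? (permutations n))

-- Block k l is {k, k+1, …, k+l-1} as a set of positions or of values.
Block : ℕ → ℕ → Pred (Fin n) 0ℓ
Block k l i = k ≤ val i × val i ≤ k + l ∸ 1

A : ∀ (l k : ℕ) → Pred (Permutation′ n) 0ℓ
A {n} l k σ = ∃[ a ] val {n} a + l ∸ 1 ≤ n ×
  (∀ v → Block k l v ⇔ (∃[ i ] Block (val a) l i × σ ⟨$⟩ʳ i ≡ v))

private
  _⇔-dec_ : ∀ {P Q : Set} → Dec P → Dec Q → Dec (P ⇔ Q)
  P? ⇔-dec Q? = map′ (λ (f , g) → mk⇔ f g) (λ e → Equivalence.to e , Equivalence.from e)
    ((P? →-dec Q?) ×-dec (Q? →-dec P?))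

Block? : ∀ k l → Decidable (Block {n} k l)
Block? k l i = (k ≤? val i) ×-dec (val i ≤? k + l ∸ 1)

A? : ∀ l k → Decidable (A {n} l k)
A? {n} l k σ = any? λ a → (val a + l ∸ 1 ≤? n) ×-dec
  all? λ v → Block? k l v ⇔-dec any? λ i → Block? (val a) l i ×-dec (σ ⟨$⟩ʳ i Fin.≟ v)

Increasing : Vec (Fin n) m → Set
Increasing ι = ∀ j j′ → j Fin.< j′ → lookup ι j Fin.< lookup ι j′

Contains : Permutation′ m → Pred (Permutation′ n) 0ℓ
Contains {m} {n} τ σ = ∃[ ι ] Increasing {n} {m} ι ×
  (∀ j j′ → σ ⟨$⟩ʳ lookup ι j Fin.< σ ⟨$⟩ʳ lookup ι j′ ⇔ τ ⟨$⟩ʳ j Fin.< τ ⟨$⟩ʳ j′)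

Avoids : Permutation′ m → Pred (Permutation′ n) 0ℓ
Avoids τ σ = ¬ Contains τ σ

private
  anyVec? : ∀ {P : Pred (Vec (Fin n) m) 0ℓ} → Decidable P → Dec (∃ P)
  anyVec? {m = zero}  P? = map′ ([] ,_) (λ { ([] , p) → p }) (P? [])
  anyVec? {m = suc m} P? =
    map′ (λ (x , xs , p) → x ∷ xs , p) (λ { (x ∷ xs , p) → x , xs , p })
      (any? λ x → anyVec? λ xs → P? (x ∷ xs))

Avoids? : (τ : Permutation′ m) → Decidable (Avoids {n = n} τ)
Avoids? τ σ = ¬? (anyVec? λ ι →
  (all? λ j → all? λ j′ → (j Fin.<? j′) →-dec (lookup ι j Fin.<? lookup ι j′)) ×-dec
  (all? λ j → all? λ j′ →
    (σ ⟨$⟩ʳ lookup ι j Fin.<? σ ⟨$⟩ʳ lookup ι j′) ⇔-dec (τ ⟨$⟩ʳ j Fin.<? τ ⟨$⟩ʳ j′)))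

∣S_⟨_⟩∣ : ℕ → Permutation′ m → ℕ
∣S n ⟨ τ ⟩∣ = ∣ Avoids? {n = n} τ ∣

-- S_n(τ) = S_n for n < m.
n<m⇒Avoids : n < m → (τ : Permutation′ m) (σ : Permutation′ n) → Avoids τ σ
n<m⇒Avoids n<m τ σ (ι , ι↑ , _) = ℕ.<⇒≱ n<m (Fin.injective⇒≤ injective)
  where
  injective : ∀ {j j′} → lookup ι j ≡ lookup ι j′ → j ≡ j′
  injective {j} {j′} eq with Fin.<-cmp j j′
  ... | tri< j<j′ _ _ = contradiction (ι↑ j j′ j<j′) (ℕ.<-irrefl (cong toℕ eq))
  ... | tri≈ _ j≡j′ _ = j≡j′
  ... | tri> _ _ j′<j = contradiction (ι↑ j′ j j′<j) (ℕ.<-irrefl (cong toℕ (sym eq)))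

private
  Avoids-resp-≈ : (τ : Permutation′ m) {σ ρ : Permutation′ n} → σ Perm.≈ ρ →
                  Avoids τ σ → Avoids τ ρ
  Avoids-resp-≈ τ p σ-avoids (ι , ι↑ , iso) = σ-avoids (ι , ι↑ , λ j j′ →
    subst₂ (λ x y → x Fin.< y ⇔ τ ⟨$⟩ʳ j Fin.< τ ⟨$⟩ʳ j′)
      (sym (p (lookup ι j))) (sym (p (lookup ι j′))) (iso j j′))

  avoider : .{{NonTrivial m}} → (τ : Permutation′ m) → ∃ (Avoids {n = n} τ)
  avoider {m = 2+ m} {n} τ with Fin.<-cmp (τ ⟨$⟩ʳ zero) (τ ⟨$⟩ʳ suc zero)
  ... | tri< τ₁<τ₂ _ _ = reverse , λ (ι , ι↑ , iso) →
    ℕ.<⇒≱ (Equivalence.from (iso zero (suc zero)) τ₁<τ₂)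
      (subst₂ _≤_ (sym (Fin.opposite-prop (lookup ι (suc zero))))
                  (sym (Fin.opposite-prop (lookup ι zero)))
        (ℕ.∸-monoʳ-≤ n (s≤s (ℕ.<⇒≤ (ι↑ zero (suc zero) z<s)))))
  ... | tri≈ _ τ₁≡τ₂ _ = contradiction
    (trans (sym (Perm.inverseˡ τ)) (trans (cong (τ Perm.⟨$⟩ˡ_) τ₁≡τ₂) (Perm.inverseˡ τ)))
    λ ()
  ... | tri> τ₁≮τ₂ _ _ = Perm.id , λ (ι , ι↑ , iso) →
    τ₁≮τ₂ (Equivalence.to (iso zero (suc zero)) (ι↑ zero (suc zero) z<s))

∣S∣-nonZero : ∀ n .{{_ : NonTrivial m}} (τ : Permutation′ m) → NonZero ∣S n ⟨ τ ⟩∣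
∣S∣-nonZero n τ with (σ , σ-avoids) ← avoider {n = n} τ =
  >-nonZero (filter-some (Avoids? τ)
    (Any.map (λ {ρ} σ≈ρ → Avoids-resp-≈ τ {σ} {ρ} σ≈ρ σ-avoids) (permutations-complete n σ)))

infixl 7 _/∣S_⟨_⟩∣

_/∣S_⟨_⟩∣ : ℕ → ∀ n .{{_ : NonTrivial m}} (τ : Permutation′ m) → ℚ
a /∣S n ⟨ τ ⟩∣ = (+ a ℚ./ ∣S n ⟨ τ ⟩∣) {{∣S∣-nonZero n τ}}

P : ∀ n .{{_ : NonTrivial m}} (τ : Permutation′ m) {E : Pred (Permutation′ n) 0ℓ} →
    Decidable E → ℚ
P n τ E? = ∣ E? ∩? Avoids? τ ∣ /∣S n ⟨ τ ⟩∣

ContainsTightly12 ContainsTightly21 : Permutation′ m → Set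
ContainsTightly12 τ = ∃[ i ] ∃[ i′ ] ∃[ h ] val i′ ≡ val i + 1 ×
  val (τ ⟨$⟩ʳ i) ≡ h × val (τ ⟨$⟩ʳ i′) ≡ h + 1
ContainsTightly21 τ = ∃[ i ] ∃[ i′ ] ∃[ h ] val i′ ≡ val i + 1 ×
  val (τ ⟨$⟩ʳ i) ≡ h + 1 × val (τ ⟨$⟩ʳ i′) ≡ h

ClusterFree : Permutation′ m → Set
ClusterFree {m} τ = ∀ l k → 2 ≤ l → l ≤ m ∸ 1 → 1 ≤ k → k + l ∸ 1 ≤ m → ¬ A l k τ

{-# OPTIONS --safe #-}

-- A σ in A^{(n)}_{l;k} is obtained from a unique pair (ρ, π) ∈ S_{n-l+1} × S_l by substituting
-- the pattern π for the entry k of ρ. Since ρ and π are patterns of σ, both avoid τ whenever σ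
-- does, which gives (i). Conversely, consider an occurrence of τ in σ. If at most one of its points
-- lies in the block, it yields an occurrence in ρ; if all do, one in π; otherwise the points in the
-- block are contiguous both in position and in value, so that τ is not cluster-free. This gives
-- (ii). If π is increasing (decreasing) and two points lie in the block, then two consecutive ones
-- exhibit 12 (21) tightly in τ, which gives (iii).
module Submission where

open import Defs
open import Data.Empty using (⊥)
open import Data.Fin.Base as Fin
  using (Fin; zero; suc; toℕ; fromℕ<; punchIn; punchOut; splitAt; join; cast; _↑ˡ_; _↑ʳ_)
open import Data.Fin.Permutation as Perm using (Permutation′; _⟨$⟩ʳ_; _⟨$⟩ˡ_)
import Data.Fin.Properties as Fin
open import Data.Integer.Base as ℤ using (+≤+)
import Data.Integer.Properties as ℤ
open import Data.List.Base as List using (List; []; _∷_; length; filter; cartesianProductWith)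
open import Data.List.Membership.Propositional.Properties using (∈-lookup)
import Data.List.Membership.Setoid.Properties as Membership
import Data.List.Properties as List
import Data.List.Relation.Unary.All as All
open import Data.List.Relation.Unary.AllPairs using ([]; _∷_)
open import Data.List.Relation.Unary.Any as Any using (here; there; index)
open import Data.List.Relation.Unary.Any.Properties using (cartesianProductWith⁺)
open import Data.List.Relation.Unary.Unique.Setoid using (Unique)
import Data.List.Relation.Unary.Unique.Setoid.Properties as Unique
open import Data.Nat.Base as ℕ
  using (ℕ; zero; suc; 2+; NonTrivial; _+_; _*_; _∸_; _≤_; _<_; z≤n; s≤s; z<s; s<s; s<s⁻¹; s≤s⁻¹)
import Data.Nat.Properties as ℕ
open import Data.Product.Base using (∃; ∃-syntax; Σ-syntax; _×_; _,_; proj₁; proj₂; map₂)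
open import Data.Rational.Base as ℚ using ()
import Data.Rational.Properties as ℚ
open import Data.Rational.Unnormalised.Base using (mkℚᵘ; *≤*)
import Data.Rational.Unnormalised.Properties as ℚᵘ
open import Data.Sum.Base as Sum using (_⊎_; inj₁; inj₂; [_,_]′)
open import Data.Sum.Function.Propositional using (_⊎-↔_)
open import Data.Sum.Properties using (inj₁-injective; inj₂-injective)
open import Data.Unit.Base using (⊤; tt)
open import Data.Vec.Base using (lookup; tabulate)
open import Data.Vec.Properties using (lookup∘tabulate)
open import Function.Base using (_∘_; const; case_of_; id)
open import Function.Bundles
  using (_⇔_; mk⇔; _↔_; mk↔ₛ′; module Equivalence; module Inverse; module Injection)
open import Function.Construct.Composition using (_⇔-∘_; _↔-∘_)
open import Function.Construct.Symmetry using (⇔-sym; ↔-sym)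
open import Function.Definitions using (Injective)
open import Function.Properties.Inverse using (↔⇒↣)
open import Level using (0ℓ)
open import Relation.Binary.Bundles using (Setoid)
open import Relation.Binary.Core using (Rel)
open import Relation.Binary.Definitions using (tri<; tri≈; tri>)
open import Relation.Binary.PropositionalEquality
  using (_≡_; _≢_; _≗_; refl; sym; trans; cong; cong₂; subst; subst₂; module ≡-Reasoning)
open import Relation.Nullary using (¬_; Dec; yes; no; contradiction)
open import Relation.Nullary.Decidable using (_×-dec_; dec-yes)
open import Relation.Unary using (Pred; Decidable)
open import Relation.Unary.Properties using (_∩?_)

open Equivalence using (to; from)

private
  variable
    l m n p : ℕ

-- Splitting Fin (p + l) at a block

-- place a sends Fin l onto the interval a, …, a + l − 1, and Fin p in order onto the complement.
place : Fin (suc p) → Fin p ⊎ Fin l → Fin (p + l)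
place {p} {l} zero s            = cast (ℕ.+-comm l p) (join l p (Sum.swap s))
place (suc a) (inj₁ zero)       = zero
place (suc a) (inj₁ (suc i))    = suc (place a (inj₁ i))
place {suc p} (suc a) (inj₂ j)  = suc (place a (inj₂ j))

locate : Fin (suc p) → Fin (p + l) → Fin p ⊎ Fin l
locate {p} {l} zero x          = Sum.swap (splitAt l (cast (ℕ.+-comm p l) x))
locate {suc p} (suc a) zero    = inj₁ zero
locate {suc p} (suc a) (suc x) = Sum.map₁ suc (locate a x)

place-locate : ∀ (a : Fin (suc p)) (x : Fin (p + l)) → place a (locate a x) ≡ x
place-locate {p} {l} zero x with splitAt l (cast (ℕ.+-comm p l) x) in eq
... | inj₁ j = trans (cong (cast _) (Fin.splitAt⁻¹-↑ˡ eq))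
    (Fin.cast-involutive (ℕ.+-comm l p) (ℕ.+-comm p l) x)
... | inj₂ i = trans (cong (cast _) (Fin.splitAt⁻¹-↑ʳ {l} eq))
    (Fin.cast-involutive (ℕ.+-comm l p) (ℕ.+-comm p l) x)
place-locate {suc p} (suc a) zero = refl
place-locate {suc p} (suc a) (suc x) with locate a x in eq
... | inj₁ i = cong suc (trans (cong (place a) (sym eq)) (place-locate a x))
... | inj₂ j = cong suc (trans (cong (place a) (sym eq)) (place-locate a x))

locate-place : ∀ (a : Fin (suc p)) (s : Fin p ⊎ Fin l) → locate a (place a s) ≡ s
locate-place {p} {l} zero s
  rewrite Fin.cast-involutive (ℕ.+-comm p l) (ℕ.+-comm l p) (join l p (Sum.swap s))
        | Fin.splitAt-join l p (Sum.swap s) with s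
... | inj₁ i = refl
... | inj₂ j = refl
locate-place {suc p} (suc a) (inj₁ zero) = refl
locate-place {suc p} (suc a) (inj₁ (suc i)) = cong (Sum.map₁ suc) (locate-place a (inj₁ i))
locate-place {suc p} (suc a) (inj₂ j) = cong (Sum.map₁ suc) (locate-place a (inj₂ j))

place-injective : ∀ (a : Fin (suc p)) {s t : Fin p ⊎ Fin l} → place a s ≡ place a t → s ≡ t
place-injective a {s} {t} eq =
  trans (sym (locate-place a s)) (trans (cong (locate a) eq) (locate-place a t))

toℕ-place-block : ∀ (a : Fin (suc p)) (j : Fin l) → toℕ (place a (inj₂ j)) ≡ toℕ a + toℕ j
toℕ-place-block {p} {l} zero j = trans (Fin.toℕ-cast _ (j ↑ˡ p)) (Fin.toℕ-↑ˡ j p)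
toℕ-place-block {suc p} (suc a) j = cong suc (toℕ-place-block a j)

IsBlock : Fin p ⊎ Fin l → Set
IsBlock (inj₁ _) = ⊥
IsBlock (inj₂ _) = ⊤

IsBlock? : ∀ (s : Fin p ⊎ Fin l) → Dec (IsBlock s)
IsBlock? (inj₁ _) = no id
IsBlock? (inj₂ _) = yes tt

block-range : ∀ (a : Fin (suc p)) (x : Fin (p + l)) →
              Block (val a) l x ⇔ (∃[ j ] place a (inj₂ j) ≡ x)
block-range {p} {l} a x = mk⇔ in-block (λ { (j , refl) → bounds j })
  where
  in-block : Block (val a) l x → ∃[ j ] place a (inj₂ j) ≡ x
  -- The 1-based upper bound `val x ≤ val a + l ∸ 1` computes to `toℕ x < toℕ a + l`, so
  -- `toℕ x ∸ toℕ a` is a valid offset inside the block.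
  in-block (a≤x , x<a+l) = fromℕ< lt , Fin.toℕ-injective (begin
    toℕ (place a (inj₂ (fromℕ< lt)))  ≡⟨ toℕ-place-block a (fromℕ< lt) ⟩
    toℕ a + toℕ (fromℕ< lt)           ≡⟨ cong (toℕ a +_) (Fin.toℕ-fromℕ< lt) ⟩
    toℕ a + (toℕ x ∸ toℕ a)           ≡⟨ ℕ.m+[n∸m]≡n (s≤s⁻¹ a≤x) ⟩
    toℕ x                             ∎)
    where
    open ≡-Reasoning
    lt : toℕ x ∸ toℕ a < l
    lt = subst (toℕ x ∸ toℕ a <_) (ℕ.m+n∸m≡n (toℕ a) l) (ℕ.∸-monoˡ-< x<a+l (s≤s⁻¹ a≤x))

  bounds : ∀ j → Block (val a) l (place a (inj₂ j))
  bounds j rewrite toℕ-place-block a j =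
    s≤s (ℕ.m≤m+n (toℕ a) (toℕ j)) , ℕ.+-monoʳ-< (toℕ a) (Fin.toℕ<n j)

-- Contracts the block to the single slot `a`: the passage from positions (or values) of `σ` to
-- those of `ρ`.
collapse : Fin (suc p) → Fin p ⊎ Fin l → Fin (suc p)
collapse a = [ punchIn a , const a ]′

private
  suc-<⇔ : ∀ {m n} {i j : Fin m} {i′ j′ : Fin n} → i Fin.< j ⇔ i′ Fin.< j′ →
           Fin.suc i Fin.< Fin.suc j ⇔ Fin.suc i′ Fin.< Fin.suc j′
  suc-<⇔ e = mk⇔ (s<s ∘ to e ∘ s<s⁻¹) (s<s ∘ from e ∘ s<s⁻¹)

place-block-< : ∀ (a : Fin (suc p)) (j j′ : Fin l) →
                place a (inj₂ j) Fin.< place a (inj₂ j′) ⇔ j Fin.< j′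
place-block-< a j j′ rewrite toℕ-place-block a j | toℕ-place-block a j′ =
  mk⇔ (ℕ.+-cancelˡ-< (toℕ a) _ _) (ℕ.+-monoʳ-< (toℕ a))

-- A point outside the block lies on the same side of every block point, and of the slot after
-- contraction; only the order of two block points is lost. Induction on `a` peels off the points
-- before the block until the block comes first.
place-< : ∀ (a : Fin (suc p)) (s t : Fin p ⊎ Fin l) → ¬ (IsBlock s × IsBlock t) →
          place a s Fin.< place a t ⇔ collapse a s Fin.< collapse a t
place-< {p} {l} zero (inj₁ i) (inj₁ i′) _
  rewrite Fin.toℕ-cast (ℕ.+-comm l p) (l ↑ʳ i) | Fin.toℕ-cast (ℕ.+-comm l p) (l ↑ʳ i′)
        | Fin.toℕ-↑ʳ l i | Fin.toℕ-↑ʳ l i′ =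
  mk⇔ (s<s ∘ ℕ.+-cancelˡ-< l _ _) (ℕ.+-monoʳ-< l ∘ s<s⁻¹)
place-< {p} {l} zero (inj₁ i) (inj₂ j) _
  rewrite Fin.toℕ-cast (ℕ.+-comm l p) (l ↑ʳ i) | Fin.toℕ-cast (ℕ.+-comm l p) (j ↑ˡ p)
        | Fin.toℕ-↑ʳ l i | Fin.toℕ-↑ˡ j p =
  mk⇔ (λ lt → contradiction lt (ℕ.≤⇒≯ (ℕ.≤-trans (ℕ.<⇒≤ (Fin.toℕ<n j)) (ℕ.m≤m+n l _)))) λ ()
place-< {p} {l} zero (inj₂ j) (inj₁ i) _
  rewrite Fin.toℕ-cast (ℕ.+-comm l p) (l ↑ʳ i) | Fin.toℕ-cast (ℕ.+-comm l p) (j ↑ˡ p)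
        | Fin.toℕ-↑ʳ l i | Fin.toℕ-↑ˡ j p =
  mk⇔ (λ _ → z<s) (λ _ → ℕ.<-≤-trans (Fin.toℕ<n j) (ℕ.m≤m+n l _))
place-< {suc p} (suc a) (inj₁ zero) (inj₁ zero) _ = mk⇔ (λ ()) (λ ())
place-< {suc p} (suc a) (inj₁ zero) (inj₁ (suc _)) _ = mk⇔ (λ _ → z<s) (λ _ → z<s)
place-< {suc p} (suc a) (inj₁ zero) (inj₂ _) _ = mk⇔ (λ _ → z<s) (λ _ → z<s)
place-< {suc p} (suc a) (inj₁ (suc _)) (inj₁ zero) _ = mk⇔ (λ ()) (λ ())
place-< {suc p} (suc a) (inj₂ _) (inj₁ zero) _ = mk⇔ (λ ()) (λ ())
place-< {suc p} (suc a) (inj₁ (suc i)) (inj₁ (suc i′)) _ =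
  suc-<⇔ (place-< a (inj₁ i) (inj₁ i′) proj₁)
place-< {suc p} (suc a) (inj₁ (suc i)) (inj₂ j) _ =
  suc-<⇔ (place-< a (inj₁ i) (inj₂ j) proj₁)
place-< {suc p} (suc a) (inj₂ j) (inj₁ (suc i)) _ =
  suc-<⇔ (place-< a (inj₂ j) (inj₁ i) proj₂)
place-< _ (inj₂ _) (inj₂ _) nb = contradiction (tt , tt) nb

-- Inflations

perm-injective : (σ : Permutation′ n) → ∀ {i j} → σ ⟨$⟩ʳ i ≡ σ ⟨$⟩ʳ j → i ≡ j
perm-injective σ = Injection.injective (↔⇒↣ σ)

place↔ : Fin (suc p) → (Fin p ⊎ Fin l) ↔ Fin (p + l)
place↔ a = mk↔ₛ′ (place a) (locate a) (place-locate a) (locate-place a)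

-- σ arises from ρ by substituting the pattern π for the entry c of ρ, which sits at position a.
record Inflates (a c : Fin (suc p)) (ρ : Permutation′ (suc p)) (π : Permutation′ l)
                (σ : Permutation′ (p + l)) : Set where
  field
    centre  : ρ ⟨$⟩ʳ a ≡ c
    block   : ∀ j → σ ⟨$⟩ʳ place a (inj₂ j) ≡ place c (inj₂ (π ⟨$⟩ʳ j))
    outside : ∀ i → ∃[ i′ ] ρ ⟨$⟩ʳ punchIn a i ≡ punchIn c i′ ×
                            σ ⟨$⟩ʳ place a (inj₁ i) ≡ place c (inj₁ i′)

open Inflates

-- In the coordinates `place a` for positions and `place c` for values, `σ` is the disjoint sum of
-- `ρ` with its entry `c` removed and `π`.
inflation : (c : Fin (suc p)) (ρ : Permutation′ (suc p)) (π : Permutation′ l) →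
            ∃ (Inflates (ρ ⟨$⟩ˡ c) c ρ π)
inflation c ρ π = σ , record
  { centre  = Perm.inverseʳ ρ
  ; block   = λ j → cong (place c ∘ step) (locate-place a (inj₂ j))
  ; outside = λ i → Perm.remove a ρ ⟨$⟩ʳ i , Perm.punchIn-permute′ ρ c i ,
                    cong (place c ∘ step) (locate-place a (inj₁ i))
  }
  where
  a = ρ ⟨$⟩ˡ c
  step = Sum.map (Perm.remove a ρ ⟨$⟩ʳ_) (π ⟨$⟩ʳ_)
  σ = (place↔ c ↔-∘ (Perm.remove a ρ ⊎-↔ π)) ↔-∘ ↔-sym (place↔ a)

punchIn-view : (a x : Fin (suc n)) → (x ≡ a) ⊎ (∃[ i ] x ≡ punchIn a i)
punchIn-view a x with a Fin.≟ x
... | yes a≡x = inj₁ (sym a≡x)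
... | no  a≢x = inj₂ (punchOut a≢x , sym (Fin.punchIn-punchOut a≢x))

-- Both blocks carry the same values, as `c` is shared. So the value of `σ` at its first block
-- position is taken by `σ′` inside its own block, which starts at `a′`. The length `suc l` ensures
-- that there is a first position.
slot-≤ : {a a′ c : Fin (suc p)} {ρ ρ′ : Permutation′ (suc p)} {π π′ : Permutation′ (suc l)}
         {σ σ′ : Permutation′ (p + suc l)} →
         Inflates a c ρ π σ → Inflates a′ c ρ′ π′ σ′ → σ Perm.≈ σ′ → a′ Fin.≤ a
slot-≤ {l = l} {a} {a′} {c} {π = π} {π′} {σ} I I′ σ≈σ′ = begin
  toℕ a′                                ≤⟨ ℕ.m≤m+n _ _ ⟩
  toℕ a′ + toℕ j                        ≡⟨ toℕ-place-block a′ j ⟨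
  toℕ (place a′ (inj₂ j))               ≡⟨ cong toℕ same ⟩
  toℕ (place {l = suc l} a (inj₂ zero)) ≡⟨ toℕ-place-block a zero ⟩
  toℕ a + 0                             ≡⟨ ℕ.+-identityʳ _ ⟩
  toℕ a                                 ∎
  where
  open ℕ.≤-Reasoning
  j = π′ ⟨$⟩ˡ (π ⟨$⟩ʳ zero)
  same : place a′ (inj₂ j) ≡ place a (inj₂ zero)
  same = perm-injective σ (trans (σ≈σ′ _) (trans (block I′ j)
    (trans (cong (place c ∘ inj₂) (Perm.inverseʳ π′)) (sym (block I zero)))))

-- Once the slots agree, injectivity of `place c` lets `π` and the remaining entries of `ρ` be read
-- off from `σ`.
inflates-injective : {a a′ c : Fin (suc p)} {ρ ρ′ : Permutation′ (suc p)}
  {π π′ : Permutation′ (suc l)} {σ σ′ : Permutation′ (p + suc l)} →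
  Inflates a c ρ π σ → Inflates a′ c ρ′ π′ σ′ → σ Perm.≈ σ′ → ρ Perm.≈ ρ′ × π Perm.≈ π′
inflates-injective {a = a} {c = c} {ρ} {ρ′} {π} {π′} I I′ σ≈σ′
  with refl ← Fin.≤-antisym (slot-≤ I′ I (sym ∘ σ≈σ′)) (slot-≤ I I′ σ≈σ′) = ρ≈ρ′ , π≈π′
  where
  π≈π′ : π Perm.≈ π′
  π≈π′ j = inj₂-injective (place-injective c
    (trans (sym (block I j)) (trans (σ≈σ′ _) (block I′ j))))
  ρ≈ρ′ : ρ Perm.≈ ρ′
  ρ≈ρ′ x with punchIn-view a x
  ... | inj₁ refl = trans (centre I) (sym (centre I′))
  ... | inj₂ (i , refl) with i₁ , ρi , σi ← outside I i | i₂ , ρ′i , σ′i ← outside I′ i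
      with refl ← place-injective c (trans (sym σi) (trans (σ≈σ′ _) σ′i)) = trans ρi (sym ρ′i)

inflates⇒A : {a c : Fin (suc p)} {ρ : Permutation′ (suc p)} {π : Permutation′ (suc l)}
             {σ : Permutation′ (p + suc l)} → Inflates a c ρ π σ → A (suc l) (val c) σ
inflates⇒A {p} {l} {a} {c} {π = π} {σ} I = a₀ , fits , λ v → mk⇔ (pull v) (push v)
  where
  -- `A` asks for a position in the whole of `Fin (p + suc l)`; the first block position has the
  -- same number as the slot `a`.
  a₀ = place a (inj₂ zero)
  a₀≡a : toℕ a₀ ≡ toℕ a
  a₀≡a = trans (toℕ-place-block a zero) (ℕ.+-identityʳ _)
  fits : toℕ a₀ + suc l ≤ p + suc l
  fits = ℕ.+-monoˡ-≤ (suc l) (subst (_≤ p) (sym a₀≡a) (Fin.toℕ≤pred[n] a))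
  Block-a₀ : ∀ i → Block (val a₀) (suc l) i ≡ Block (val a) (suc l) i
  Block-a₀ i = cong (λ z → Block (suc z) (suc l) i) a₀≡a
  pull : ∀ v → Block (val c) (suc l) v → ∃[ i ] Block (val a₀) (suc l) i × σ ⟨$⟩ʳ i ≡ v
  pull v v∈ with j , refl ← to (block-range c v) v∈ =
    place a (inj₂ (π ⟨$⟩ˡ j)) ,
    subst id (sym (Block-a₀ _)) (from (block-range a _) (π ⟨$⟩ˡ j , refl)) ,
    trans (block I (π ⟨$⟩ˡ j)) (cong (place c ∘ inj₂) (Perm.inverseʳ π))
  push : ∀ v → ∃[ i ] Block (val a₀) (suc l) i × σ ⟨$⟩ʳ i ≡ v → Block (val c) (suc l) v
  push v (i , i∈ , refl) with j , refl ← to (block-range a i) (subst id (Block-a₀ i) i∈) =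
    from (block-range c _) (π ⟨$⟩ʳ j , sym (block I j))

-- `h` and `k` choose the maps in the two directions, and injectivity makes them mutually inverse.
-- This extracts `π` from `σ` on the block, and the rest of `ρ` on the complement.
restrict : ∀ {U V X Y : Set} (f : X → Y) {u : U → X} {v : V → Y} →
           Injective _≡_ _≡_ f → Injective _≡_ _≡_ u → Injective _≡_ _≡_ v →
           (∀ x → ∃[ y ] f (u x) ≡ v y) → (∀ y → ∃[ x ] f (u x) ≡ v y) →
           Σ[ r ∈ U ↔ V ] ∀ x → f (u x) ≡ v (Inverse.to r x)
restrict f {u} {v} f-inj u-inj v-inj h k =
  mk↔ₛ′ (proj₁ ∘ h) (proj₁ ∘ k)
    (λ y → v-inj (trans (sym (proj₂ (h (proj₁ (k y))))) (proj₂ (k y))))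
    (λ x → u-inj (f-inj (trans (proj₂ (k (proj₁ (h x)))) (sym (proj₂ (h x)))))) ,
  proj₂ ∘ h

insert-centre : (a c : Fin (suc n)) (r : Permutation′ n) → Perm.insert a c r ⟨$⟩ʳ a ≡ c
insert-centre a c r rewrite proj₂ (dec-yes (a Fin.≟ a) refl) = refl

A⇒inflates : {c : Fin (suc p)} {σ : Permutation′ (p + l)} → A l (val c) σ →
             ∃[ a ] ∃[ ρ ] ∃[ π ] Inflates a c ρ π σ
A⇒inflates {p} {l} {c} {σ} (a₀ , fits , iso) =
  a , Perm.insert a c r , π , record
    { centre  = insert-centre a c r
    ; block   = π-eq
    ; outside = λ i → r ⟨$⟩ʳ i , Perm.insert-punchIn a c r i , r-eq i
    }
  where
  a≤p : toℕ a₀ < suc p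
  -- `fits` computes to `toℕ a₀ + l ≤ p + l`, so the starting position is a slot.
  a≤p = s≤s (ℕ.+-cancelʳ-≤ l _ _ fits)
  a = fromℕ< a≤p
  Block-a : ∀ i → Block (val a₀) l i ≡ Block (val a) l i
  Block-a i = cong (λ z → Block (suc z) l i) (sym (Fin.toℕ-fromℕ< a≤p))

  block→ : ∀ j → ∃[ j′ ] σ ⟨$⟩ʳ place a (inj₂ j) ≡ place c (inj₂ j′)
  block→ j = map₂ sym (to (block-range c _) (from (iso _)
    (_ , subst id (sym (Block-a _)) (from (block-range a _) (j , refl)) , refl)))
  block← : ∀ j′ → ∃[ j ] σ ⟨$⟩ʳ place a (inj₂ j) ≡ place c (inj₂ j′)
  block← j′ with i , i∈ , eq ← to (iso _) (from (block-range c _) (j′ , refl))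
    with j , refl ← to (block-range a i) (subst id (Block-a i) i∈) = j , eq

  -- A block value here would also be taken at a block position, by `block←`, against injectivity of
  -- `σ`.
  outside→ : ∀ i → ∃[ i′ ] σ ⟨$⟩ʳ place a (inj₁ i) ≡ place c (inj₁ i′)
  outside→ i with locate c (σ ⟨$⟩ʳ place a (inj₁ i)) | place-locate c (σ ⟨$⟩ʳ place a (inj₁ i))
  ... | inj₁ i′ | eq = i′ , sym eq
  ... | inj₂ j′ | eq with j , eq′ ← block← j′ =
    contradiction (place-injective a (perm-injective σ (trans eq′ eq))) λ ()
  -- Dually, a preimage inside the block would have a block value, by `block→`.
  outside← : ∀ i′ → ∃[ i ] σ ⟨$⟩ʳ place a (inj₁ i) ≡ place c (inj₁ i′)
  outside← i′ with locate a (σ ⟨$⟩ˡ place c (inj₁ i′)) | place-locate a (σ ⟨$⟩ˡ place c (inj₁ i′))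
  ... | inj₁ i | eq = i , trans (cong (σ ⟨$⟩ʳ_) eq) (Perm.inverseʳ σ)
  ... | inj₂ j | eq with j′ , eq′ ← block→ j =
    contradiction (place-injective c
      (trans (sym eq′) (trans (cong (σ ⟨$⟩ʳ_) eq) (Perm.inverseʳ σ)))) λ ()

  block-restriction = restrict (σ ⟨$⟩ʳ_) (perm-injective σ) (inj₂-injective ∘ place-injective a)
                (inj₂-injective ∘ place-injective c) block→ block←
  outside-restriction = restrict (σ ⟨$⟩ʳ_) (perm-injective σ) (inj₁-injective ∘ place-injective a)
                (inj₁-injective ∘ place-injective c) outside→ outside←
  π = proj₁ block-restriction
  π-eq = proj₂ block-restriction
  r = proj₁ outside-restriction
  r-eq = proj₂ outside-restriction

-- Occurrences of patterns in inflations

-- Positions form a function instead of a vector, so that occurrences compose with `place a` and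
-- `collapse a`.
Occurs : Permutation′ m → Permutation′ n → (Fin m → Fin n) → Set
Occurs τ σ f = (∀ {i j} → i Fin.< j → f i Fin.< f j) ×
  (∀ i j → σ ⟨$⟩ʳ f i Fin.< σ ⟨$⟩ʳ f j ⇔ τ ⟨$⟩ʳ i Fin.< τ ⟨$⟩ʳ j)

occurs-cong : {τ : Permutation′ m} {σ : Permutation′ n} {f g : Fin m → Fin n} →
              f ≗ g → Occurs τ σ f → Occurs τ σ g
occurs-cong {τ = τ} {σ} f≗g (f↑ , iso) =
  (λ {i} {j} i<j → subst₂ Fin._<_ (f≗g i) (f≗g j) (f↑ i<j)) ,
  λ i j → subst₂ (λ x y → σ ⟨$⟩ʳ x Fin.< σ ⟨$⟩ʳ y ⇔ τ ⟨$⟩ʳ i Fin.< τ ⟨$⟩ʳ j)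
            (f≗g i) (f≗g j) (iso i j)

contains⇔occurs : {τ : Permutation′ m} {σ : Permutation′ n} → Contains τ σ ⇔ ∃ (Occurs τ σ)
contains⇔occurs {τ = τ} {σ} = mk⇔
  (λ (ι , ι↑ , iso) → lookup ι , (λ {i} {j} → ι↑ i j) , iso)
  (λ (f , occ) → let f↑ , iso = occurs-cong {τ = τ} {σ} (sym ∘ lookup∘tabulate f) occ in
    tabulate f , (λ i j → f↑) , iso)

contains-cong : {τ : Permutation′ m} {σ σ′ : Permutation′ n} → σ Perm.≈ σ′ →
                Contains τ σ → Contains τ σ′
contains-cong {τ = τ} p (ι , ι↑ , iso) = ι , ι↑ , λ j j′ →
  subst₂ (λ x y → x Fin.< y ⇔ τ ⟨$⟩ʳ j Fin.< τ ⟨$⟩ʳ j′)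
    (p (lookup ι j)) (p (lookup ι j′)) (iso j j′)

increasing-injective : (f : Fin m → Fin n) → (∀ {i j} → i Fin.< j → f i Fin.< f j) →
                       ∀ {i j} → f i ≡ f j → i ≡ j
increasing-injective f f↑ {i} {j} eq with Fin.<-cmp i j
... | tri< i<j _ _ = contradiction eq (Fin.<⇒≢ (f↑ i<j))
... | tri≈ _ i≡j _ = i≡j
... | tri> _ _ j<i = contradiction (sym eq) (Fin.<⇒≢ (f↑ j<i))

module _ {a c : Fin (suc p)} {ρ : Permutation′ (suc p)} {π : Permutation′ l}
         {σ : Permutation′ (p + l)} (I : Inflates a c ρ π σ) where

  -- One and the same `t` describes the value in `σ` through `place c` and the value in `ρ` through
  -- `collapse c`, so `place-<` applies to values just as it does to positions.
  image : ∀ s → ∃[ t ] σ ⟨$⟩ʳ place a s ≡ place c t × ρ ⟨$⟩ʳ collapse a s ≡ collapse c t ×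
                       (IsBlock s ⇔ IsBlock t)
  image (inj₁ i) with i′ , ρi , σi ← outside I i = inj₁ i′ , σi , ρi , mk⇔ id id
  image (inj₂ j) = inj₂ (π ⟨$⟩ʳ j) , block I j , centre I , mk⇔ id id

  image-block : ∀ x → IsBlock (locate a x) ⇔ IsBlock (locate c (σ ⟨$⟩ʳ x))
  image-block x with t , σs , _ , s⇔t ← image (locate a x)
    rewrite place-locate a x | σs | locate-place c t = s⇔t

  image-< : ∀ s t → ¬ (IsBlock s × IsBlock t) →
            σ ⟨$⟩ʳ place a s Fin.< σ ⟨$⟩ʳ place a t ⇔
            ρ ⟨$⟩ʳ collapse a s Fin.< ρ ⟨$⟩ʳ collapse a t
  image-< s t ¬both
    with s′ , σs , ρs , s-block ← image s | t′ , σt , ρt , t-block ← image t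
    rewrite σs | ρs | σt | ρt =
    place-< c s′ t′ (λ (x , y) → ¬both (from s-block x , from t-block y))

  module _ {τ : Permutation′ m} where

    -- Two distinct points are never both in the block, so `place-<` transports their order, in
    -- position and in value, both ways.
    occurs-collapse : {s : Fin m → Fin p ⊎ Fin l} →
      (∀ i j → IsBlock (s i) → IsBlock (s j) → i ≡ j) →
      Occurs τ σ (place a ∘ s) ⇔ Occurs τ ρ (collapse a ∘ s)
    occurs-collapse {s} sparse = mk⇔
      (λ (f↑ , iso) → (λ i<j → to (position i<j) (f↑ i<j)) , λ i j → iso i j ⇔-∘ ⇔-sym (value i j))
      (λ (f↑ , iso) → (λ i<j → from (position i<j) (f↑ i<j)) , λ i j → iso i j ⇔-∘ value i j)
      where
      ¬both : ∀ {i j} → i ≢ j → ¬ (IsBlock (s i) × IsBlock (s j))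
      ¬both i≢j (x , y) = i≢j (sparse _ _ x y)
      position : ∀ {i j} → i Fin.< j →
                 place a (s i) Fin.< place a (s j) ⇔ collapse a (s i) Fin.< collapse a (s j)
      position i<j = place-< a _ _ (¬both (Fin.<⇒≢ i<j))
      value : ∀ i j → σ ⟨$⟩ʳ place a (s i) Fin.< σ ⟨$⟩ʳ place a (s j) ⇔
                      ρ ⟨$⟩ʳ collapse a (s i) Fin.< ρ ⟨$⟩ʳ collapse a (s j)
      value i j with i Fin.≟ j
      ... | yes refl = mk⇔ (λ x<x → contradiction x<x (ℕ.<-irrefl refl))
                           (λ x<x → contradiction x<x (ℕ.<-irrefl refl))
      ... | no  i≢j  = image-< (s i) (s j) (¬both i≢j)

    occurs-block : {h : Fin m → Fin l} → Occurs τ σ (place a ∘ inj₂ ∘ h) ⇔ Occurs τ π h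
    occurs-block {h} = mk⇔
      (λ (f↑ , iso) → (λ i<j → to (place-block-< a _ _) (f↑ i<j)) ,
                      λ i j → iso i j ⇔-∘ ⇔-sym (value i j))
      (λ (f↑ , iso) → (λ i<j → from (place-block-< a _ _) (f↑ i<j)) ,
                      λ i j → iso i j ⇔-∘ value i j)
      where
      value : ∀ i j → σ ⟨$⟩ʳ place a (inj₂ (h i)) Fin.< σ ⟨$⟩ʳ place a (inj₂ (h j)) ⇔
                      π ⟨$⟩ʳ h i Fin.< π ⟨$⟩ʳ h j
      value i j rewrite block I (h i) | block I (h j) = place-block-< c _ _

    contains-block : Contains τ π → Contains τ σ
    contains-block π∋τ with h , occ ← to (contains⇔occurs {τ = τ} {π}) π∋τ =
      from (contains⇔occurs {τ = τ} {σ}) (_ , from occurs-block occ)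

    -- The block point `j₀` stands in for the entry of `ρ` at `a`; the resulting `lift` is a section
    -- of `collapse a` that meets the block only over `a`.
    contains-outside : Fin l → Contains τ ρ → Contains τ σ
    contains-outside j₀ ρ∋τ with f , occ ← to (contains⇔occurs {τ = τ} {ρ}) ρ∋τ =
      from (contains⇔occurs {τ = τ} {σ}) (_ , from (occurs-collapse sparse)
        (occurs-cong {τ = τ} {ρ} (sym ∘ section ∘ f) occ))
      where
      lift : Fin (suc p) → Fin p ⊎ Fin l
      lift x = [ const (inj₂ j₀) , inj₁ ∘ proj₁ ]′ (punchIn-view a x)
      section : ∀ x → collapse a (lift x) ≡ x
      section x with punchIn-view a x
      ... | inj₁ x≡a       = sym x≡a
      ... | inj₂ (i , x≡i) = sym x≡i
      lift-block : ∀ x → IsBlock (lift x) → x ≡ a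
      lift-block x _ with punchIn-view a x
      ... | inj₁ x≡a = x≡a
      sparse : ∀ i j → IsBlock (lift (f i)) → IsBlock (lift (f j)) → i ≡ j
      sparse i j bi bj = increasing-injective f (proj₁ occ)
        (trans (lift-block (f i) bi) (sym (lift-block (f j) bj)))

-- Convex sets of positions: clusters and tight pairs

Convex : Pred (Fin m) 0ℓ → Set
Convex Q = ∀ {i j k} → i Fin.< j → j Fin.< k → Q i → Q k → Q j

-- Induction on `m`, removing position 0. The empty set appears as `s ≡ t`; `t ≤ m` ensures that
-- otherwise the left end `s` is a position.
interval : {Q : Pred (Fin m) 0ℓ} → Decidable Q → Convex Q →
           ∃[ s ] ∃[ t ] s ≤ t × t ≤ m × (∀ i → Q i ⇔ (s ≤ toℕ i × toℕ i < t))
interval {zero} Q? convex = 0 , 0 , z≤n , z≤n , λ ()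
interval {suc m} {Q} Q? convex
  with interval {m} (Q? ∘ suc) (λ i<j j<k → convex (s<s i<j) (s<s j<k)) | Q? zero
... | s , t , s≤t , t≤m , iff | no ¬Q0 = suc s , suc t , s≤s s≤t , s≤s t≤m , λ where
  zero    → mk⇔ (λ Q0 → contradiction Q0 ¬Q0) λ ()
  (suc i) → mk⇔ (λ Qi → let s≤i , i<t = to (iff i) Qi in s≤s s≤i , s<s i<t)
                (λ (s≤i , i<t) → from (iff i) (s≤s⁻¹ s≤i , s<s⁻¹ i<t))
... | s , t , s≤t , t≤m , iff | yes Q0 with s ℕ.≟ t
-- The tail is empty, so position 0 is the only member.
...   | yes refl = 0 , 1 , z≤n , s≤s z≤n , λ where
  zero    → mk⇔ (λ _ → z≤n , z<s) (λ _ → Q0)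
  (suc i) → mk⇔ (λ Qi → let s≤i , i<s = to (iff i) Qi in contradiction i<s (ℕ.≤⇒≯ s≤i))
                (λ { (_ , s<s ()) })
-- Position 0 and the first point of the tail interval are both members, so convexity fills the gap
-- between them.
...   | no s≢t = 0 , suc t , z≤n , s≤s t≤m , λ
  { zero    → mk⇔ (λ _ → z≤n , z<s) (λ _ → Q0)
  ; (suc i) → mk⇔ (λ Qi → z≤n , s<s (proj₂ (to (iff i) Qi))) (λ (_ , i<t) → below i (s<s⁻¹ i<t))
  }
  where
  below : ∀ i → toℕ i < t → Q (suc i)
  below i i<t with s ℕ.≤? toℕ i
  ... | yes s≤i = from (iff i) (s≤i , i<t)
  ... | no  s≰i = convex z<s (s<s i<s) Q0 (from (iff s′)
          (ℕ.≤-reflexive (sym s′≡s) , subst (_< t) (sym s′≡s) s<t))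
    where
    s<t = ℕ.≤∧≢⇒< s≤t s≢t
    s′ = fromℕ< (ℕ.<-≤-trans s<t t≤m)
    s′≡s = Fin.toℕ-fromℕ< (ℕ.<-≤-trans s<t t≤m)
    i<s : i Fin.< s′
    i<s = subst (toℕ i <_) (sym s′≡s) (ℕ.≰⇒> s≰i)

-- Pigeonhole: sending `j` to the value of `τ` at `s + j`, shifted down by `s′`, is injective. Used
-- for `τ` and for its inverse, this shows that two intervals have equal length.
interval-≤ : ∀ {s t s′ t′} (τ : Permutation′ m) → s ≤ t → t ≤ m →
             (∀ i → s ≤ toℕ i → toℕ i < t → s′ ≤ toℕ (τ ⟨$⟩ʳ i) × toℕ (τ ⟨$⟩ʳ i) < t′) →
             t ∸ s ≤ t′ ∸ s′
interval-≤ {m} {s} {t} {s′} {t′} τ s≤t t≤m maps = Fin.injective⇒≤ {f = g} g-injective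
  where
  s+j<t : ∀ (j : Fin (t ∸ s)) → s + toℕ j < t
  s+j<t j = subst (s + toℕ j <_) (ℕ.m+[n∸m]≡n s≤t) (ℕ.+-monoʳ-< s (Fin.toℕ<n j))
  shift : Fin (t ∸ s) → Fin m
  shift j = fromℕ< (ℕ.<-≤-trans (s+j<t j) t≤m)
  shift-toℕ : ∀ j → toℕ (shift j) ≡ s + toℕ j
  shift-toℕ j = Fin.toℕ-fromℕ< (ℕ.<-≤-trans (s+j<t j) t≤m)
  bounds : ∀ j → s′ ≤ toℕ (τ ⟨$⟩ʳ shift j) × toℕ (τ ⟨$⟩ʳ shift j) < t′
  bounds j = maps (shift j) (subst (s ≤_) (sym (shift-toℕ j)) (ℕ.m≤m+n s _))
                            (subst (_< t) (sym (shift-toℕ j)) (s+j<t j))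
  g-lt : ∀ j → toℕ (τ ⟨$⟩ʳ shift j) ∸ s′ < t′ ∸ s′
  g-lt j = ℕ.∸-monoˡ-< (proj₂ (bounds j)) (proj₁ (bounds j))
  g : Fin (t ∸ s) → Fin (t′ ∸ s′)
  g j = fromℕ< (g-lt j)
  g-injective : Injective _≡_ _≡_ g
  g-injective {j} {j′} eq = Fin.toℕ-injective (ℕ.+-cancelˡ-≡ s _ _
    (trans (sym (shift-toℕ j)) (trans (cong toℕ shift≡) (shift-toℕ j′))))
    where
    shift≡ : shift j ≡ shift j′
    shift≡ = perm-injective τ (Fin.toℕ-injective (ℕ.∸-cancelʳ-≡
      (proj₁ (bounds j)) (proj₁ (bounds j′))
      (trans (sym (Fin.toℕ-fromℕ< (g-lt j))) (trans (cong toℕ eq) (Fin.toℕ-fromℕ< (g-lt j′))))))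

module _ (τ : Permutation′ m) {Q : Pred (Fin m) 0ℓ} (convex : Convex Q) where

  private
    inverse-< : ∀ {x y} → x Fin.< y → τ ⟨$⟩ʳ (τ ⟨$⟩ˡ x) Fin.< τ ⟨$⟩ʳ (τ ⟨$⟩ˡ y)
    inverse-< = subst₂ Fin._<_ (sym (Perm.inverseʳ τ)) (sym (Perm.inverseʳ τ))

  -- Convexity in position and in value makes `Q` and its image under `τ` intervals. They have the
  -- same length, which is at least 2 because of `i` and `j`, and less than `m` because of `o`. In
  -- 1-based counting the values start at `suc s′`.
  cluster : Decidable Q →
    (∀ {i j k} → τ ⟨$⟩ʳ i Fin.< τ ⟨$⟩ʳ j → τ ⟨$⟩ʳ j Fin.< τ ⟨$⟩ʳ k → Q i → Q k → Q j) →
    ∀ {i j o} → i Fin.< j → Q i → Q j → ¬ Q o → ¬ ClusterFree τ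
  cluster Q? value-convex {i} {j} {o} i<j Qi Qj ¬Qo cluster-free
    with s , t , s≤t , t≤m , iff ← interval Q? convex
       | s′ , t′ , s′≤t′ , t′≤m , iff′ ← interval (Q? ∘ (τ ⟨$⟩ˡ_))
           (λ x<y y<z → value-convex (inverse-< x<y) (inverse-< y<z)) =
    cluster-free (t ∸ s) (suc s′) 2≤l l≤m-1 (s≤s z≤n) s′+l≤m
      (a , subst (_≤ m) (sym a+l≡t) t≤m , λ v → mk⇔ (pull v) (push v))
    where
    s+l≡t : s + (t ∸ s) ≡ t
    s+l≡t = ℕ.m+[n∸m]≡n s≤t
    lengths : t ∸ s ≡ t′ ∸ s′
    lengths = ℕ.≤-antisym
      (interval-≤ τ s≤t t≤m λ i s≤i i<t →
        to (iff′ _) (subst Q (sym (Perm.inverseˡ τ)) (from (iff i) (s≤i , i<t))))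
      (interval-≤ (Perm.flip τ) s′≤t′ t′≤m λ i s≤i i<t → to (iff _) (from (iff′ i) (s≤i , i<t)))
    s′+l≡t′ : s′ + (t ∸ s) ≡ t′
    s′+l≡t′ = trans (cong (s′ +_) lengths) (ℕ.m+[n∸m]≡n s′≤t′)
    s′+l≤m = subst (_≤ m) (sym s′+l≡t′) t′≤m
    s<m : s < m
    s<m = ℕ.≤-<-trans (proj₁ (to (iff i) Qi)) (Fin.toℕ<n i)
    a = fromℕ< s<m
    a≡s = Fin.toℕ-fromℕ< s<m
    a+l≡t : toℕ a + (t ∸ s) ≡ t
    a+l≡t = trans (cong (_+ (t ∸ s)) a≡s) s+l≡t
    2≤l : 2 ≤ t ∸ s
    2≤l = ℕ.m+n≤o⇒m≤o∸n 2 (begin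
      2 + s               ≤⟨ s≤s (s≤s (proj₁ (to (iff i) Qi))) ⟩
      suc (suc (toℕ i))   ≤⟨ s≤s i<j ⟩
      suc (toℕ j)         ≤⟨ proj₂ (to (iff j) Qj) ⟩
      t                   ∎)
      where open ℕ.≤-Reasoning
    s≡0 : m ≤ t ∸ s → s ≡ 0
    s≡0 m≤l = ℕ.n≤0⇒n≡0 (ℕ.+-cancelʳ-≤ (t ∸ s) s 0
      (ℕ.≤-trans (ℕ.≤-reflexive s+l≡t) (ℕ.≤-trans t≤m m≤l)))
    -- A length of `m` or more would force `s ≡ 0` and `m ≤ t`, which puts `o` into `Q`.
    l≤m-1 : t ∸ s ≤ m ∸ 1
    l≤m-1 = ℕ.<⇒≤pred (ℕ.≰⇒> λ m≤l → ¬Qo (from (iff o)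
      ( subst (_≤ toℕ o) (sym (s≡0 m≤l)) z≤n
      , ℕ.<-≤-trans (Fin.toℕ<n o) (ℕ.≤-trans m≤l (ℕ.m∸n≤m t s)))))
    pull : ∀ v → Block (suc s′) (t ∸ s) v → ∃[ x ] Block (val a) (t ∸ s) x × τ ⟨$⟩ʳ x ≡ v
    pull v (s′≤v , v<t′)
      with s≤x , x<t ← to (iff (τ ⟨$⟩ˡ v))
                          (from (iff′ v) (s≤s⁻¹ s′≤v , subst (toℕ v <_) s′+l≡t′ v<t′)) =
      τ ⟨$⟩ˡ v ,
      (s≤s (subst (_≤ _) (sym a≡s) s≤x) , subst (toℕ (τ ⟨$⟩ˡ v) <_) (sym a+l≡t) x<t) ,
      Perm.inverseʳ τ
    push : ∀ v → ∃[ x ] Block (val a) (t ∸ s) x × τ ⟨$⟩ʳ x ≡ v → Block (suc s′) (t ∸ s) v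
    push v (x , (a≤x , x<a+l) , refl)
      with s′≤v , v<t′ ← to (iff′ _) (subst Q (sym (Perm.inverseˡ τ)) (from (iff x)
             (subst (_≤ toℕ x) a≡s (s≤s⁻¹ a≤x) , subst (toℕ x <_) a+l≡t x<a+l))) =
      s≤s s′≤v , subst (toℕ (τ ⟨$⟩ʳ x) <_) (sym s′+l≡t′) v<t′

  -- The order ≺ on values is either _<_ or its converse.
  consecutive : {_≺_ : Rel (Fin m) 0ℓ} → (∀ {x y} → x ≺ y → ¬ y ≺ x) →
    (∀ {i j k} → (τ ⟨$⟩ʳ i) ≺ (τ ⟨$⟩ʳ j) → (τ ⟨$⟩ʳ j) ≺ (τ ⟨$⟩ʳ k) → Q i → Q k → Q j) →
    (∀ {i j} → i Fin.< j → Q i → Q j → (τ ⟨$⟩ʳ i) ≺ (τ ⟨$⟩ʳ j)) →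
    ∀ {i j} → i Fin.< j → Q i → Q j →
    ∃[ i′ ] toℕ i′ ≡ suc (toℕ i) × (τ ⟨$⟩ʳ i) ≺ (τ ⟨$⟩ʳ i′) ×
            (∀ v → ¬ ((τ ⟨$⟩ʳ i) ≺ v × v ≺ (τ ⟨$⟩ʳ i′)))
  consecutive {_≺_} asym value-convex mono {i} {j} i<j Qi Qj =
    i′ , i′≡1+i , mono i<i′ Qi Qi′ , λ v (lo , hi) → nothing-between (τ ⟨$⟩ˡ v)
      (subst ((τ ⟨$⟩ʳ i) ≺_) (sym (Perm.inverseʳ τ)) lo)
      (subst (_≺ (τ ⟨$⟩ʳ i′)) (sym (Perm.inverseʳ τ)) hi)
    where
    1+i<m = ℕ.≤-<-trans i<j (Fin.toℕ<n j)
    i′ = fromℕ< 1+i<m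
    i′≡1+i = Fin.toℕ-fromℕ< 1+i<m
    i<i′ : i Fin.< i′
    i<i′ = ℕ.≤-reflexive (sym i′≡1+i)
    Qi′ : Q i′
    Qi′ with Fin.<-cmp i′ j
    ... | tri< i′<j _ _ = convex i<i′ i′<j Qi Qj
    ... | tri≈ _ i′≡j _ = subst Q (sym i′≡j) Qj
    ... | tri> _ _ j<i′ = contradiction i<j (ℕ.<⇒≱ (subst (toℕ j <_) i′≡1+i j<i′))
    -- By value convexity the position `u` of an intermediate value lies in `Q`; monotonicity on `Q`
    -- then forces `u` strictly between `i` and its successor.
    nothing-between : ∀ u → (τ ⟨$⟩ʳ i) ≺ (τ ⟨$⟩ʳ u) → ¬ (τ ⟨$⟩ʳ u) ≺ (τ ⟨$⟩ʳ i′)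
    nothing-between u lo hi with Fin.<-cmp u i | Fin.<-cmp i′ u
    ... | tri< u<i _ _  | _              = asym lo (mono u<i (value-convex lo hi Qi Qi′) Qi)
    ... | tri≈ _ refl _ | _              = asym lo lo
    ... | tri> _ _ _    | tri< i′<u _ _  = asym hi (mono i′<u Qi′ (value-convex lo hi Qi Qi′))
    ... | tri> _ _ _    | tri≈ _ refl _  = asym hi hi
    ... | tri> _ _ i<u  | tri> _ _ u<i′  =
      contradiction i<u (ℕ.<⇒≱ (subst (toℕ u <_) i′≡1+i u<i′))

no-gap : {x y : Fin m} → x Fin.< y → (∀ v → ¬ (x Fin.< v × v Fin.< y)) → toℕ y ≡ toℕ x + 1
no-gap {x = x} {y} x<y empty = trans (ℕ.≤-antisym (ℕ.≮⇒≥ λ 1+x<y →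
    let v<m = ℕ.<-trans 1+x<y (Fin.toℕ<n y) ; v≡ = Fin.toℕ-fromℕ< v<m in
    empty (fromℕ< v<m) (ℕ.≤-reflexive (sym v≡) , subst (_< toℕ y) (sym v≡) 1+x<y)) x<y)
  (ℕ.+-comm 1 (toℕ x))

-- How an occurrence of τ meets the block

isBlock⇔Block : ∀ (a : Fin (suc p)) (x : Fin (p + l)) → IsBlock (locate a x) ⇔ Block (val a) l x
isBlock⇔Block {p} {l} a x = mk⇔ (from (block-range a x) ∘ located) λ x∈ →
  case to (block-range a x) x∈ of λ
    { (j , refl) → subst IsBlock (sym (locate-place a (inj₂ j))) tt }
  where
  located : IsBlock (locate a x) → ∃[ j ] place {l = l} a (inj₂ j) ≡ x
  located s-block with locate a x | place-locate a x
  ... | inj₂ j | eq = j , eq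

module _ {a c : Fin (suc p)} {ρ : Permutation′ (suc p)} {π : Permutation′ l}
         {σ : Permutation′ (p + l)} (I : Inflates a c ρ π σ) {τ : Permutation′ m} where

  private
    module _ {f : Fin m → Fin (p + l)} (occ : Occurs τ σ f) where

      InBlock : Pred (Fin m) 0ℓ
      InBlock i = IsBlock (locate a (f i))

      InBlock? : Decidable InBlock
      InBlock? i = IsBlock? (locate a (f i))

      positions-convex : Convex InBlock
      positions-convex {i} {j} {k} i<j j<k i∈ k∈ = from (isBlock⇔Block a (f j))
        ( ℕ.≤-trans (proj₁ (to (isBlock⇔Block a (f i)) i∈)) (s≤s (ℕ.<⇒≤ (proj₁ occ i<j)))
        , ℕ.≤-trans (s≤s (ℕ.<⇒≤ (proj₁ occ j<k))) (proj₂ (to (isBlock⇔Block a (f k)) k∈)))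

      -- Block positions are exactly those with block values, so membership can be tested on values
      -- as well; this gives convexity for the value order of `τ`.
      inBlock⇔value : ∀ i → InBlock i ⇔ Block (val c) l (σ ⟨$⟩ʳ f i)
      inBlock⇔value i = isBlock⇔Block c (σ ⟨$⟩ʳ f i) ⇔-∘ image-block I (f i)

      values-convex : ∀ {i j k} → τ ⟨$⟩ʳ i Fin.< τ ⟨$⟩ʳ j → τ ⟨$⟩ʳ j Fin.< τ ⟨$⟩ʳ k →
                      InBlock i → InBlock k → InBlock j
      values-convex {i} {j} {k} i<j j<k i∈ k∈ = from (inBlock⇔value j)
        ( ℕ.≤-trans (proj₁ (to (inBlock⇔value i) i∈)) (s≤s (ℕ.<⇒≤ (from (proj₂ occ i j) i<j)))
        , ℕ.≤-trans (s≤s (ℕ.<⇒≤ (from (proj₂ occ j k) j<k))) (proj₂ (to (inBlock⇔value k) k∈)))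

      f-locate : ∀ i → f i ≡ place a (locate a (f i))
      f-locate i = sym (place-locate a (f i))

      -- The dichotomy behind (ii) and (iii): an occurrence with at most one point in the block
      -- collapses to one in `ρ`.
      two-in-block : Contains τ ρ ⊎ (∃[ i ] ∃[ j ] i Fin.< j × InBlock i × InBlock j)
      two-in-block
        with Fin.any? (λ i → Fin.any? (λ j → i Fin.<? j ×-dec InBlock? i ×-dec InBlock? j))
      ... | yes two = inj₂ two
      ... | no ¬two = inj₁ (from (contains⇔occurs {τ = τ} {ρ})
        (_ , to (occurs-collapse I {τ = τ} {s = locate a ∘ f} sparse)
               (occurs-cong {τ = τ} {σ} f-locate occ)))
        where
        sparse : ∀ i j → InBlock i → InBlock j → i ≡ j
        sparse i j i∈ j∈ with Fin.<-cmp i j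
        ... | tri< i<j _ _ = contradiction (i , j , i<j , i∈ , j∈) ¬two
        ... | tri≈ _ i≡j _ = i≡j
        ... | tri> _ _ j<i = contradiction (j , i , j<i , j∈ , i∈) ¬two

      all-in-block : (∀ i → InBlock i) → Contains τ π
      all-in-block ∀∈ = from (contains⇔occurs {τ = τ} {π})
        (_ , to (occurs-block I {τ = τ} {h = proj₁ ∘ inner})
               (occurs-cong {τ = τ} {σ} (proj₂ ∘ inner) occ))
        where
        inner : ∀ i → ∃[ j ] f i ≡ place a (inj₂ j)
        inner i = map₂ sym (to (block-range a _) (to (isBlock⇔Block a _) (∀∈ i)))

      in-block-values : ∀ {i j} → i Fin.< j → InBlock i → InBlock j → ∃[ x ] ∃[ y ] x Fin.< y ×
        σ ⟨$⟩ʳ f i ≡ place c (inj₂ (π ⟨$⟩ʳ x)) × σ ⟨$⟩ʳ f j ≡ place c (inj₂ (π ⟨$⟩ʳ y))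
      in-block-values {i} {j} i<j i∈ j∈
        with x , x≡ ← to (block-range a _) (to (isBlock⇔Block a _) i∈)
           | y , y≡ ← to (block-range a _) (to (isBlock⇔Block a _) j∈) =
        x , y , to (place-block-< a x y) (subst₂ Fin._<_ (sym x≡) (sym y≡) (proj₁ occ i<j)) ,
        trans (cong (σ ⟨$⟩ʳ_) (sym x≡)) (block I x) , trans (cong (σ ⟨$⟩ʳ_) (sym y≡)) (block I y)

      increasing-in-block : (∀ {x y} → x Fin.< y → π ⟨$⟩ʳ x Fin.< π ⟨$⟩ʳ y) → ∀ {i j} → i Fin.< j →
                            InBlock i → InBlock j → τ ⟨$⟩ʳ i Fin.< τ ⟨$⟩ʳ j
      increasing-in-block π↑ {i} {j} i<j i∈ j∈
        with x , y , x<y , σi , σj ← in-block-values i<j i∈ j∈ = to (proj₂ occ i j)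
        (subst₂ Fin._<_ (sym σi) (sym σj) (from (place-block-< c _ _) (π↑ x<y)))

      decreasing-in-block : (∀ {x y} → x Fin.< y → π ⟨$⟩ʳ y Fin.< π ⟨$⟩ʳ x) → ∀ {i j} → i Fin.< j →
                            InBlock i → InBlock j → τ ⟨$⟩ʳ j Fin.< τ ⟨$⟩ʳ i
      decreasing-in-block π↓ {i} {j} i<j i∈ j∈
        with x , y , x<y , σi , σj ← in-block-values i<j i∈ j∈ = to (proj₂ occ j i)
        (subst₂ Fin._<_ (sym σj) (sym σi) (from (place-block-< c _ _) (π↓ x<y)))

      -- With `π` increasing, `τ` increases on `InBlock`. By convexity the position after `i` is in
      -- the block too, and no value fits between the two.
      tight-increasing : (∀ {x y} → x Fin.< y → π ⟨$⟩ʳ x Fin.< π ⟨$⟩ʳ y) →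
                         ∀ {i j} → i Fin.< j → InBlock i → InBlock j → ContainsTightly12 τ
      tight-increasing π↑ {i} i<j i∈ j∈ =
        let i′ , i′≡1+i , up , empty = consecutive τ positions-convex {Fin._<_} ℕ.<-asym
              values-convex (increasing-in-block π↑) i<j i∈ j∈
        in i , i′ , val (τ ⟨$⟩ʳ i) , trans (cong suc i′≡1+i) (ℕ.+-comm 1 _) , refl ,
           cong suc (no-gap up empty)

      tight-decreasing : (∀ {x y} → x Fin.< y → π ⟨$⟩ʳ y Fin.< π ⟨$⟩ʳ x) →
                         ∀ {i j} → i Fin.< j → InBlock i → InBlock j → ContainsTightly21 τ
      tight-decreasing π↓ {i} i<j i∈ j∈ =
        let i′ , i′≡1+i , down , empty = consecutive τ positions-convex {λ x y → y Fin.< x} ℕ.<-asym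
              -- Under the converse order the two outer points of value convexity trade places.
              (λ j<i k<j i∈ k∈ → values-convex k<j j<i k∈ i∈) (decreasing-in-block π↓) i<j i∈ j∈
        in i , i′ , val (τ ⟨$⟩ʳ i′) , trans (cong suc i′≡1+i) (ℕ.+-comm 1 _) ,
           cong suc (no-gap down λ v (lo , hi) → empty v (hi , lo)) , refl

  contains-clusterFree : ClusterFree τ → Contains τ σ → Contains τ ρ ⊎ Contains τ π
  contains-clusterFree cluster-free σ∋τ
    with f , occ ← to (contains⇔occurs {τ = τ} {σ}) σ∋τ
    with two-in-block occ | Fin.all? (InBlock? occ)
  ... | inj₁ ρ∋τ                    | _       = inj₁ ρ∋τ
  ... | inj₂ _                      | yes all = inj₂ (all-in-block occ all)
  ... | inj₂ (i , j , i<j , i∈ , j∈) | no ¬all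
    with o , o∉ ← Fin.¬∀⟶∃¬ m (InBlock occ) (InBlock? occ) ¬all =
    contradiction cluster-free
      (cluster τ (positions-convex occ) (InBlock? occ) (values-convex occ) i<j i∈ j∈ o∉)

  contains-increasing : (∀ {x y} → x Fin.< y → π ⟨$⟩ʳ x Fin.< π ⟨$⟩ʳ y) →
                        Contains τ σ → Contains τ ρ ⊎ ContainsTightly12 τ
  contains-increasing π↑ σ∋τ = let _ , occ = to (contains⇔occurs {τ = τ} {σ}) σ∋τ in
    Sum.map₂ (λ (_ , _ , i<j , i∈ , j∈) → tight-increasing occ π↑ i<j i∈ j∈) (two-in-block occ)

  contains-decreasing : (∀ {x y} → x Fin.< y → π ⟨$⟩ʳ y Fin.< π ⟨$⟩ʳ x) →
                        Contains τ σ → Contains τ ρ ⊎ ContainsTightly21 τ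
  contains-decreasing π↓ σ∋τ = let _ , occ = to (contains⇔occurs {τ = τ} {σ}) σ∋τ in
    Sum.map₂ (λ (_ , _ , i<j , i∈ , j∈) → tight-decreasing occ π↓ i<j i∈ j∈) (two-in-block occ)

-- Counting

module _ {A : Setoid 0ℓ 0ℓ} where
  open Setoid A using (Carrier; _≈_) renaming (sym to ≈-sym; trans to ≈-trans)
  open import Data.List.Membership.Setoid A using () renaming (_∈_ to _∈ₛ_)

  lookup-injective : {xs : List Carrier} → Unique A xs →
                     ∀ i j → List.lookup xs i ≈ List.lookup xs j → i ≡ j
  lookup-injective (x≉ ∷ _) zero    zero    _  = refl
  lookup-injective (x≉ ∷ _) zero    (suc j) eq = contradiction eq (All.lookup x≉ (∈-lookup j))
  lookup-injective (x≉ ∷ _) (suc i) zero    eq =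
    contradiction (≈-sym eq) (All.lookup x≉ (∈-lookup i))
  lookup-injective (_ ∷ xs!) (suc i) (suc j) eq = cong suc (lookup-injective xs! i j eq)

  -- Each index of `xs` goes to an index of an equivalent element of `ys`. Equal target indices mean
  -- equivalent elements, hence equal indices by uniqueness.
  unique-⊆⇒length-≤ : {xs ys : List Carrier} → Unique A xs → (∀ {x} → x ∈ₛ xs → x ∈ₛ ys) →
                      length xs ≤ length ys
  unique-⊆⇒length-≤ {xs} xs! xs⊆ys = Fin.injective⇒≤ {f = λ i → index (member i)} λ {i} {j} eq →
    lookup-injective xs! i j (Membership.index-injective A (member i) (member j) eq)
    where
    member = λ i → xs⊆ys (Membership.∈-lookup A xs i)

length-cartesianProductWith : ∀ {A B C : Set} (f : A → B → C) xs ys →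
  length (cartesianProductWith f xs ys) ≡ length xs * length ys
length-cartesianProductWith f []       ys = refl
length-cartesianProductWith f (x ∷ xs) ys = trans (List.length-++ (List.map (f x) ys))
  (cong₂ _+_ (List.length-map (f x) ys) (length-cartesianProductWith f xs ys))

-- `ℚ._/_` reduces to lowest terms, so the comparison is made between unnormalised fractions, where
-- the denominator is still shared.
+/-mono-≤ : ∀ {a b} d .{{_ : ℕ.NonZero d}} → a ≤ b → ℤ.+ a ℚ./ d ℚ.≤ ℤ.+ b ℚ./ d
+/-mono-≤ {a} {b} (suc d) a≤b = ℚ.toℚᵘ-cancel-≤ (begin
  ℚ.toℚᵘ (ℚ.fromℚᵘ (mkℚᵘ (ℤ.+ a) d))  ≃⟨ ℚ.toℚᵘ-fromℚᵘ (mkℚᵘ (ℤ.+ a) d) ⟩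
  mkℚᵘ (ℤ.+ a) d                      ≤⟨ *≤* (ℤ.*-monoʳ-≤-nonNeg (ℤ.+ suc d) (+≤+ a≤b)) ⟩
  mkℚᵘ (ℤ.+ b) d                      ≃⟨ ℚ.toℚᵘ-fromℚᵘ (mkℚᵘ (ℤ.+ b) d) ⟨
  ℚ.toℚᵘ (ℚ.fromℚᵘ (mkℚᵘ (ℤ.+ b) d))  ∎)
  where open ℚᵘ.≤-Reasoning

infix 4 _∈_
_∈_ : Permutation′ n → List (Permutation′ n) → Set
σ ∈ xs = Any.Any (σ Perm.≈_) xs

-- Lists of permutations are searched up to `≈`, so a filtered list represents a predicate only if
-- the predicate respects `≈`.
Extensional : Pred (Permutation′ n) 0ℓ → Set
Extensional E = ∀ σ σ′ → σ Perm.≈ σ′ → E σ → E σ′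

A-extensional : ∀ l k → Extensional {n} (A l k)
A-extensional l k σ σ′ σ≈σ′ (a , fits , iso) = a , fits , λ v → mk⇔
  (λ v∈ → let i , i∈ , σi≡v = to (iso v) v∈ in i , i∈ , trans (sym (σ≈σ′ i)) σi≡v)
  (λ (i , i∈ , σ′i≡v) → from (iso v) (i , i∈ , trans (σ≈σ′ i) σ′i≡v))

avoids-extensional : (τ : Permutation′ m) → Extensional {n} (Avoids τ)
avoids-extensional τ σ σ′ σ≈σ′ avoids = avoids ∘ contains-cong {τ = τ} {σ′} {σ} (sym ∘ σ≈σ′)

module _ {E : Pred (Permutation′ n) 0ℓ} (E? : Decidable E) (ext : Extensional E) where

  ∈-filter⁺ : ∀ σ → E σ → σ ∈ filter E? (permutations n)
  ∈-filter⁺ σ = Membership.∈-filter⁺ (S-setoid n) E? (λ {σ} {σ′} → ext σ σ′) {v = σ}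
    (permutations-complete n σ)

  ∈-filter⁻ : ∀ σ → σ ∈ filter E? (permutations n) → E σ
  ∈-filter⁻ σ σ∈ = proj₂ (Membership.∈-filter⁻ (S-setoid n) E? (λ {σ} {σ′} → ext σ σ′)
    {v = σ} {xs = permutations n} σ∈)

  filter-unique : Unique (S-setoid n) (filter E? (permutations n))
  filter-unique = Unique.filter⁺ (S-setoid n) E? (permutations-unique n)

  ∣∣≤length : ∀ xs → (∀ σ → E σ → σ ∈ xs) → ∣ E? ∣ ≤ length xs
  ∣∣≤length xs covers = unique-⊆⇒length-≤ {S-setoid n} filter-unique
    λ {σ} σ∈ → covers σ (∈-filter⁻ σ σ∈)

  length≤∣∣ : ∀ {xs} → Unique (S-setoid n) xs → (∀ σ → σ ∈ xs → E σ) → length xs ≤ ∣ E? ∣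
  length≤∣∣ xs! sound = unique-⊆⇒length-≤ {S-setoid n} xs!
    λ {σ} σ∈ → ∈-filter⁺ σ (sound σ σ∈)

-- The slot must be the position of `c` in `ρ`, and then `σ` is prescribed at every place.
inflates-cong : ∀ {p l} {a a′ c : Fin (suc p)} {ρ ρ′ : Permutation′ (suc p)}
  {π π′ : Permutation′ l} {σ σ′ : Permutation′ (p + l)} →
  Inflates a c ρ π σ → Inflates a′ c ρ′ π′ σ′ → ρ Perm.≈ ρ′ → π Perm.≈ π′ → σ Perm.≈ σ′
inflates-cong {a = a} {c = c} {ρ} {ρ′} {π} {π′} {σ} {σ′} I I′ ρ≈ρ′ π≈π′
  with refl ← perm-injective ρ (trans (centre I) (trans (sym (centre I′)) (sym (ρ≈ρ′ _)))) =
  λ x → subst (λ x → σ ⟨$⟩ʳ x ≡ σ′ ⟨$⟩ʳ x) (place-locate a x) (on-places (locate a x))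
  where
  on-places : ∀ s → σ ⟨$⟩ʳ place a s ≡ σ′ ⟨$⟩ʳ place a s
  on-places (inj₁ i) with i₁ , ρi , σi ← outside I i | i₂ , ρ′i , σ′i ← outside I′ i =
    trans σi (trans (cong (place c ∘ inj₁)
      (Fin.punchIn-injective c i₁ i₂ (trans (sym ρi) (trans (ρ≈ρ′ _) ρ′i)))) (sym σ′i))
  on-places (inj₂ j) =
    trans (block I j) (trans (cong (place c ∘ inj₂) (π≈π′ j)) (sym (block I′ j)))

-- Counting the avoiders with a prescribed cluster

module _ {p l : ℕ} (c : Fin (suc p)) (τ : Permutation′ m) where

  -- With block length `suc l` and degree `p + suc l`, the permutation `ρ` has degree `suc p`, the
  -- block is non-empty, and k becomes `val c` for an entry `c` of `ρ`.
  Clustered : Pred (Permutation′ (p + suc l)) 0ℓ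
  Clustered σ = A (suc l) (val c) σ × Avoids τ σ

  Clustered? : Decidable Clustered
  Clustered? = A? (suc l) (val c) ∩? Avoids? τ

  private
    clustered-extensional : Extensional Clustered
    clustered-extensional σ σ′ σ≈σ′ (σ∈A , avoids) =
      A-extensional (suc l) (val c) σ σ′ σ≈σ′ σ∈A , avoids-extensional τ σ σ′ σ≈σ′ avoids

    inflate : Permutation′ (suc p) → Permutation′ (suc l) → Permutation′ (p + suc l)
    inflate ρ π = proj₁ (inflation c ρ π)

    inflate-inflates : ∀ ρ π → Inflates (ρ ⟨$⟩ˡ c) c ρ π (inflate ρ π)
    inflate-inflates ρ π = proj₂ (inflation c ρ π)

    avoiders : ∀ n → List (Permutation′ n)
    avoiders n = filter (Avoids? τ) (permutations n)

    inflated : List (Permutation′ (suc l)) → List (Permutation′ (p + suc l))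
    inflated = cartesianProductWith inflate (avoiders (suc p))

    inflated-unique : ∀ {ys} → Unique (S-setoid (suc l)) ys →
                      Unique (S-setoid (p + suc l)) (inflated ys)
    inflated-unique = Unique.cartesianProductWith⁺ (S-setoid _) (S-setoid _) (S-setoid _) inflate
      (λ {ρ} {ρ′} {π} {π′} → inflates-injective (inflate-inflates ρ π) (inflate-inflates ρ′ π′))
      (filter-unique (Avoids? τ) (avoids-extensional τ))

  -- Both constituents of an inflation are patterns of it and inherit avoidance, so the inflations
  -- of pairs of avoiders cover the set.
  clustered-≤ : ∣ Clustered? ∣ ≤ ∣S suc p ⟨ τ ⟩∣ * ∣S suc l ⟨ τ ⟩∣
  clustered-≤ = ℕ.≤-trans
    (∣∣≤length Clustered? clustered-extensional (inflated (avoiders (suc l))) covers)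
    (ℕ.≤-reflexive (length-cartesianProductWith inflate (avoiders (suc p)) (avoiders (suc l))))
    where
    covered : ∀ {σ} → ∃[ a ] ∃[ ρ ] ∃[ π ] Inflates a c ρ π σ → Avoids τ σ →
              σ ∈ inflated (avoiders (suc l))
    covered (a , ρ , π , I) avoids =
      cartesianProductWith⁺ inflate
        -- `σ` comes with a slot of its own; `inflates-cong` identifies it with the listed inflation
        -- of an equivalent pair.
        (λ {ρ′} {π′} → inflates-cong I (inflate-inflates ρ′ π′))
        (∈-filter⁺ (Avoids? τ) (avoids-extensional τ) ρ (avoids ∘ contains-outside I {τ = τ} zero))
        (∈-filter⁺ (Avoids? τ) (avoids-extensional τ) π (avoids ∘ contains-block I {τ = τ}))

    covers : ∀ σ → Clustered σ → σ ∈ inflated (avoiders (suc l))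
    covers σ (σ∈A , avoids) = covered (A⇒inflates {σ = σ} σ∈A) avoids

  -- `ys` lists block patterns that create no new occurrence of `τ`: all avoiders for (ii); the
  -- identity, the reversal or both for (iii). Distinct pairs have distinct inflations.
  clustered-≥ : ∀ {ys} → Unique (S-setoid (suc l)) ys →
    (∀ {a ρ π σ} → π ∈ ys → Inflates a c ρ π σ → Avoids τ ρ → Avoids τ σ) →
    ∣S suc p ⟨ τ ⟩∣ * length ys ≤ ∣ Clustered? ∣
  clustered-≥ {ys} ys! good = ℕ.≤-trans
    (ℕ.≤-reflexive (sym (length-cartesianProductWith inflate (avoiders (suc p)) ys)))
    (length≤∣∣ Clustered? clustered-extensional (inflated-unique ys!) sound)
    where
    sound : ∀ σ → σ ∈ inflated ys → Clustered σ
    sound σ σ∈ with ρ , π , ρ∈ , π∈ , σ≈ ← Membership.∈-cartesianProductWith⁻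
        (S-setoid _) (S-setoid _) (S-setoid (p + suc l)) inflate (avoiders (suc p)) ys {v = σ} σ∈ =
      clustered-extensional (inflate ρ π) σ (sym ∘ σ≈)
        ( inflates⇒A (inflate-inflates ρ π)
        , good π∈ (inflate-inflates ρ π) (∈-filter⁻ (Avoids? τ) (avoids-extensional τ) ρ ρ∈))

module _ {p : ℕ} (c : Fin (suc p)) (τ : Permutation′ m) where

  private
    id-increasing : {π : Permutation′ n} → π Perm.≈ Perm.id →
                    ∀ {x y} → x Fin.< y → π ⟨$⟩ʳ x Fin.< π ⟨$⟩ʳ y
    id-increasing π≈id x<y = subst₂ Fin._<_ (sym (π≈id _)) (sym (π≈id _)) x<y

    reverse-decreasing : {π : Permutation′ n} → π Perm.≈ Perm.reverse →
                         ∀ {x y} → x Fin.< y → π ⟨$⟩ʳ y Fin.< π ⟨$⟩ʳ x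
    reverse-decreasing {n} π≈rev {x} {y} x<y = subst₂ Fin._<_ (sym (π≈rev y)) (sym (π≈rev x))
      (subst₂ _<_ (sym (Fin.opposite-prop y)) (sym (Fin.opposite-prop x))
        (ℕ.∸-monoʳ-< (s<s x<y) (Fin.toℕ<n y)))

    -- This takes two points, as on one point the identity is its own reversal; hence the block
    -- length `2+ l` in the bound with factor 2.
    id≉reverse : ∀ {l} → ¬ Perm.id {2+ l} Perm.≈ Perm.reverse
    id≉reverse id≈rev with () ← id≈rev zero

    id-avoids : ¬ ContainsTightly12 τ → ∀ {l a ρ σ} {π : Permutation′ l} → π Perm.≈ Perm.id →
                Inflates a c ρ π σ → Avoids τ ρ → Avoids τ σ
    id-avoids ¬12 {π = π} π≈id I ρ-avoids =
      [ ρ-avoids , ¬12 ]′ ∘ contains-increasing I {τ} (id-increasing {π = π} π≈id)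

    reverse-avoids : ¬ ContainsTightly21 τ → ∀ {l a ρ σ} {π : Permutation′ l} →
                     π Perm.≈ Perm.reverse → Inflates a c ρ π σ → Avoids τ ρ → Avoids τ σ
    reverse-avoids ¬21 {π = π} π≈rev I ρ-avoids =
      [ ρ-avoids , ¬21 ]′ ∘ contains-decreasing I {τ} (reverse-decreasing {π = π} π≈rev)

  clustered-clusterFree : ∀ {l} → ClusterFree τ →
    ∣ Clustered? {l = l} c τ ∣ ≡ ∣S suc p ⟨ τ ⟩∣ * ∣S suc l ⟨ τ ⟩∣
  clustered-clusterFree cluster-free = ℕ.≤-antisym (clustered-≤ c τ)
    (clustered-≥ c τ (filter-unique (Avoids? τ) (avoids-extensional τ))
      λ {_} {_} {π} π∈ I ρ-avoids →
        [ ρ-avoids , ∈-filter⁻ (Avoids? τ) (avoids-extensional τ) π π∈ ]′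
        ∘ contains-clusterFree I {τ} cluster-free)

  clustered-≥₁ : ∀ {l} → ¬ ContainsTightly12 τ ⊎ ¬ ContainsTightly21 τ →
                 ∣S suc p ⟨ τ ⟩∣ ≤ ∣ Clustered? {l = l} c τ ∣
  clustered-≥₁ (inj₁ ¬12) = ℕ.≤-trans (ℕ.≤-reflexive (sym (ℕ.*-identityʳ ∣S suc p ⟨ τ ⟩∣)))
    (clustered-≥ c τ {Perm.id ∷ []} (All.[] ∷ [])
      λ { {π = π} (here π≈id) → id-avoids ¬12 {π = π} π≈id })
  clustered-≥₁ (inj₂ ¬21) = ℕ.≤-trans (ℕ.≤-reflexive (sym (ℕ.*-identityʳ ∣S suc p ⟨ τ ⟩∣)))
    (clustered-≥ c τ {Perm.reverse ∷ []} (All.[] ∷ [])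
      λ { {π = π} (here π≈rev) → reverse-avoids ¬21 {π = π} π≈rev })

  clustered-≥₂ : ∀ {l} → ¬ ContainsTightly12 τ → ¬ ContainsTightly21 τ →
                 2 * ∣S suc p ⟨ τ ⟩∣ ≤ ∣ Clustered? {l = suc l} c τ ∣
  clustered-≥₂ {l} ¬12 ¬21 = ℕ.≤-trans (ℕ.≤-reflexive (ℕ.*-comm 2 ∣S suc p ⟨ τ ⟩∣))
    (clustered-≥ c τ {Perm.id ∷ Perm.reverse ∷ []}
      ((id≉reverse {l} All.∷ All.[]) ∷ All.[] ∷ [])
      λ { {π = π} (here π≈id)          → id-avoids ¬12 {π = π} π≈id
        ; {π = π} (there (here π≈rev)) → reverse-avoids ¬21 {π = π} π≈rev
        })

-- From counts to probabilities

/∣S∣-mono-≤ : ∀ n .{{_ : NonTrivial m}} (τ : Permutation′ m) a b → a ≤ b →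
              a /∣S n ⟨ τ ⟩∣ ℚ.≤ b /∣S n ⟨ τ ⟩∣
/∣S∣-mono-≤ n τ a b = +/-mono-≤ {a} {b} ∣S n ⟨ τ ⟩∣ {{∣S∣-nonZero n τ}}

-- The claims with their common denominator cleared. Keeping `n`, `q` and `k` as variables allows
-- transport along equations such as `n ∸ 2+ l + 2+ l ≡ n`.
Counts : (τ : Permutation′ m) (n q l k : ℕ) → Set
Counts τ n q l k =
  (N ≤ ∣S q ⟨ τ ⟩∣ * ∣S l ⟨ τ ⟩∣)
  × (ClusterFree τ → N ≡ ∣S q ⟨ τ ⟩∣ * ∣S l ⟨ τ ⟩∣)
  × (¬ ContainsTightly12 τ ⊎ ¬ ContainsTightly21 τ → ∣S q ⟨ τ ⟩∣ ≤ N)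
  × (¬ ContainsTightly12 τ × ¬ ContainsTightly21 τ → 2 * ∣S q ⟨ τ ⟩∣ ≤ N)
  where N = ∣ A? {n} l k ∩? Avoids? τ ∣

counts : (τ : Permutation′ m) {p : ℕ} (c : Fin (suc p)) (l : ℕ) →
         Counts τ (p + 2+ l) (suc p) (2+ l) (val c)
counts τ c l = clustered-≤ c τ , clustered-clusterFree c τ , clustered-≥₁ c τ ,
               λ (¬12 , ¬21) → clustered-≥₂ c τ ¬12 ¬21

counts-cong : (τ : Permutation′ m) {n n′ q q′ l k k′ : ℕ} →
              n ≡ n′ → q ≡ q′ → k ≡ k′ → Counts τ n q l k → Counts τ n′ q′ l k′
counts-cong τ refl refl refl counts = counts

counts-at : (τ : Permutation′ m) (n l k : ℕ) → 2+ l ≤ n → suc k + 2+ l ∸ 1 ≤ n →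
            Counts τ n (n ∸ 2+ l + 1) (2+ l) (suc k)
counts-at τ n l k l≤n fits = counts-cong τ {d + 2+ l} {n} {suc d} {d + 1} {2+ l} {val c} {suc k}
    d+l≡n (ℕ.+-comm 1 d) (cong suc (Fin.toℕ-fromℕ< k<1+d)) (counts τ c l)
  where
  d = n ∸ 2+ l
  d+l≡n : d + 2+ l ≡ n
  d+l≡n = ℕ.m∸n+n≡m l≤n
  -- `fits` computes to `k + 2+ l ≤ n`. The 1-based bound `suc k` is the value of the zero-based
  -- entry `k` of a permutation of degree `suc d`.
  k<1+d : k < suc d
  k<1+d = s≤s (ℕ.+-cancelʳ-≤ (2+ l) k d (subst (k + 2+ l ≤_) (sym d+l≡n) fits))
  c = fromℕ< k<1+d

theorem1 : (m : ℕ) .{{_ : NonTrivial m}} (τ : Permutation′ m)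
    (n l k : ℕ) → 3 ≤ n → 2 ≤ l → l ≤ n ∸ 1 → 1 ≤ k → k + l ∸ 1 ≤ n →
    (P n τ (A? l k) ℚ.≤ (∣S n ∸ l + 1 ⟨ τ ⟩∣ * ∣S l ⟨ τ ⟩∣) /∣S n ⟨ τ ⟩∣)
    × (ClusterFree τ →
    P n τ (A? l k) ≡ (∣S n ∸ l + 1 ⟨ τ ⟩∣ * ∣S l ⟨ τ ⟩∣) /∣S n ⟨ τ ⟩∣)
    × ((¬ ContainsTightly12 τ) ⊎ (¬ ContainsTightly21 τ) →
    P n τ (A? l k) ℚ.≥ ∣S n ∸ l + 1 ⟨ τ ⟩∣ /∣S n ⟨ τ ⟩∣)
    × ((¬ ContainsTightly12 τ) × (¬ ContainsTightly21 τ) →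
    P n τ (A? l k) ℚ.≥ (2 * ∣S n ∸ l + 1 ⟨ τ ⟩∣) /∣S n ⟨ τ ⟩∣)
theorem1 m τ n (2+ l) (suc k) _ (s≤s (s≤s z≤n)) l≤n-1 _ fits =
  -- All four fractions are over the size of `S_n(τ)`, so only the numerators have to be compared.
  let upper , exact , lower₁ , lower₂ = counts-at τ n l k (ℕ.≤-trans l≤n-1 (ℕ.m∸n≤m n 1)) fits in
  /∣S∣-mono-≤ n τ N (q * ∣S 2+ l ⟨ τ ⟩∣) upper ,
  (λ cluster-free → cong (λ a → a /∣S n ⟨ τ ⟩∣) (exact cluster-free)) ,
  (λ ¬12⊎¬21 → /∣S∣-mono-≤ n τ q N (lower₁ ¬12⊎¬21)) ,
  (λ ¬12×¬21 → /∣S∣-mono-≤ n τ (2 * q) N (lower₂ ¬12×¬21))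
  where
  N = ∣ A? {n} (2+ l) (suc k) ∩? Avoids? τ ∣
  q = ∣S n ∸ 2+ l + 1 ⟨ τ ⟩∣
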